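{- Let $h=(h(n))_{n\ge1}$ be a sequence of positive real numbers with $h(1)=1$. For every $n\ge1$, \[ P_n^h(z)=\det\left(zH_n^{ -1}L_n-U_n\right). \]
   Context: Let $\sigma(k)=\sum_{d\mid k}d$. The generalized D'Arcais polynomials are defined by $P_0^h(z)=1$ and $P_n^h(z)=\frac{z}{h(n)}\sum_{k=1}^n\sigma(k)P_{n-k}^h(z)$ for $n\ge1$. The $n\times n$ matrices are: $H_n=\operatorname{diag}(h(1),h(2),\ldots,h(n))$; $L_n$ with entries $(L_n)_{ij}=\sigma(i-j+1)$ if $i\ge j$ and $(L_n)_{ij}=0$ if $i<j$; and $U_n$ with entries $(U_n)_{ij}=1$ if $j=i+1$ and $(U_n)_{ij}=0$ otherwise. -}

module Defs where

open import Level using (0ℓ)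
open import Algebra.Bundles using (CommutativeRing)
open import Algebra.Bundles.Raw using (RawRing)
open import Algebra.Structures using (IsCommutativeRing)
import Algebra.Definitions.RawMonoid as RawMonoidDefinitions
import Algebra.Definitions.RawSemiring as RawSemiringDefinitions
open import Data.Bool.Base using (if_then_else_)
open import Data.Fin.Base as Fin using (Fin; zero; suc; toℕ; punchIn)
import Data.Fin.Properties as Fin
import Data.Integer.Base as ℤ
open import Data.List.Base as List using (List; []; _∷_)
open import Data.Nat.Base as ℕ using (ℕ; zero; suc; _∸_; NonZero)
import Data.Nat.Properties as ℕ
open import Data.Nat.Divisibility using (_∣?_)
open import Data.Nat.ListAction using () renaming (sum to sumℕ)
open import Data.Product.Base using (∃; _×_; _,_; proj₁; proj₂)
open import Data.Rational.Base as ℚ using (ℚ; 0ℚ; 1ℚ; ½; ∣_∣; Positive; _⊔_)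
import Data.Rational.Properties as ℚ
open import Data.Rational.Solver using (module +-*-Solver)
open import Data.Vec.Base as Vec using (Vec; []; _∷_)
open import Data.Vec.Functional using (Vector)
open import Relation.Binary.PropositionalEquality
  using (_≡_; refl; sym; trans; cong; cong₂; subst; module ≡-Reasoning)
open import Relation.Nullary.Decidable.Core using (does)

-- Real numbers: Cauchy sequences of rationals, where two sequences are
-- identified when their difference tends to 0.

Small : (ℕ → ℕ → ℚ) → Set
Small f = ∀ ε .{{_ : Positive ε}} →
  ∃ λ N → ∀ m n → N ℕ.≤ m → N ℕ.≤ n → ∣ f m n ∣ ℚ.< ε

record ℝ : Set where
  no-eta-equality
  field
    seq    : ℕ → ℚ
    cauchy : Small (λ m n → seq m ℚ.- seq n)
open ℝ public

infix 4 _≈_ _<_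

record _≈_ (x y : ℝ) : Set where
  constructor mk≈
  field
    close : ∀ ε .{{_ : Positive ε}} →
      ∃ λ N → ∀ n → N ℕ.≤ n → ∣ seq x n ℚ.- seq y n ∣ ℚ.< ε
open _≈_ public

_<_ : ℝ → ℝ → Set
x < y = ∃ λ ε → Positive ε ×
  ∃ λ N → ∀ n → N ℕ.≤ n → ε ℚ.≤ seq y n ℚ.- seq x n

private
  Bounded : (ℕ → ℚ) → Set
  Bounded f = ∃ λ B → Positive B ×
    ∃ λ N → ∀ n → N ℕ.≤ n → ∣ f n ∣ ℚ.≤ B

  small-zero : ∀ {f} → (∀ m n → f m n ≡ 0ℚ) → Small f
  small-zero f≡0 ε = 0 , λ m n _ _ →
    subst (ℚ._< ε) (cong ∣_∣ (sym (f≡0 m n))) (ℚ.positive⁻¹ ε)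

  small-cong : ∀ {f g} N → (∀ m n → N ℕ.≤ m → N ℕ.≤ n → f m n ≡ g m n) →
               Small f → Small g
  small-cong N f≡g F ε = let M , p = F ε in N ℕ.⊔ M , λ m n a b →
    subst (λ t → ∣ t ∣ ℚ.< ε)
      (f≡g m n (ℕ.≤-trans (ℕ.m≤m⊔n N M) a) (ℕ.≤-trans (ℕ.m≤m⊔n N M) b))
      (p m n (ℕ.≤-trans (ℕ.m≤n⊔m N M) a) (ℕ.≤-trans (ℕ.m≤n⊔m N M) b))

  small-neg : ∀ {f} → Small f → Small (λ m n → ℚ.- f m n)
  small-neg {f} F ε = let M , p = F ε in M , λ m n a b →
    subst (ℚ._< ε) (sym (ℚ.∣-p∣≡∣p∣ (f m n))) (p m n a b)

  small-+ : ∀ {f g} → Small f → Small g → Small (λ m n → f m n ℚ.+ g m n)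
  small-+ {f} {g} F G ε = M ℕ.⊔ N , λ m n a b → begin-strict
      ∣ f m n ℚ.+ g m n ∣      ≤⟨ ℚ.∣p+q∣≤∣p∣+∣q∣ (f m n) (g m n) ⟩
      ∣ f m n ∣ ℚ.+ ∣ g m n ∣  <⟨ ℚ.+-mono-<
        (p m n (ℕ.≤-trans (ℕ.m≤m⊔n M N) a) (ℕ.≤-trans (ℕ.m≤m⊔n M N) b))
        (q m n (ℕ.≤-trans (ℕ.m≤n⊔m M N) a) (ℕ.≤-trans (ℕ.m≤n⊔m M N) b)) ⟩
      δ ℚ.+ δ                  ≡⟨ ℚ.*-distribʳ-+ ε ½ ½ ⟨
      1ℚ ℚ.* ε                 ≡⟨ ℚ.*-identityˡ ε ⟩
      ε                        ∎
    where
    open ℚ.≤-Reasoning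
    δ = ½ ℚ.* ε
    instance _ = ℚ.pos*pos⇒pos ½ ε
    M = proj₁ (F δ)
    p = proj₂ (F δ)
    N = proj₁ (G δ)
    q = proj₂ (G δ)

  -- The index at which the bounded factor is evaluated is selected by φ.
  small-* : ∀ {f g} (φ : ℕ → ℕ → ℕ) →
            (∀ {N} m n → N ℕ.≤ m → N ℕ.≤ n → N ℕ.≤ φ m n) →
            Bounded f → Small g → Small (λ m n → f (φ m n) ℚ.* g m n)
  small-* {f} {g} φ φ-≥ (B , B>0 , M , b) G ε = M ℕ.⊔ N , λ m n r s →
    let k  = φ m n
        bk = b k (φ-≥ m n (ℕ.≤-trans (ℕ.m≤m⊔n M N) r) (ℕ.≤-trans (ℕ.m≤m⊔n M N) s))
        gk = p m n (ℕ.≤-trans (ℕ.m≤n⊔m M N) r) (ℕ.≤-trans (ℕ.m≤n⊔m M N) s)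
    in begin-strict
      ∣ f k ℚ.* g m n ∣        ≡⟨ ℚ.∣p*q∣≡∣p∣*∣q∣ (f k) (g m n) ⟩
      ∣ f k ∣ ℚ.* ∣ g m n ∣    ≤⟨ ℚ.*-monoʳ-≤-nonNeg ∣ g m n ∣ {{ℚ.nonNegative (ℚ.0≤∣p∣ (g m n))}} bk ⟩
      B ℚ.* ∣ g m n ∣          <⟨ ℚ.*-monoʳ-<-pos B gk ⟩
      B ℚ.* (ℚ.1/ B ℚ.* ε)     ≡⟨ ℚ.*-assoc B (ℚ.1/ B) ε ⟨
      B ℚ.* ℚ.1/ B ℚ.* ε       ≡⟨ cong (ℚ._* ε) (ℚ.*-inverseʳ B) ⟩
      1ℚ ℚ.* ε                 ≡⟨ ℚ.*-identityˡ ε ⟩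
      ε                        ∎
    where
    open ℚ.≤-Reasoning
    instance
      _ = B>0
      B≢0 = ℚ.pos⇒nonZero B
      1/B>0 = ℚ.1/pos⇒pos B
    δ = ℚ.1/ B ℚ.* ε
    instance _ = ℚ.pos*pos⇒pos (ℚ.1/ B) ε
    N = proj₁ (G δ)
    p = proj₂ (G δ)

  bounded : ∀ x → Bounded (seq x)
  bounded x = ∣ seq x N ∣ ℚ.+ 1ℚ
            , ℚ.nonNeg+pos⇒pos ∣ seq x N ∣ {{ℚ.nonNegative (ℚ.0≤∣p∣ (seq x N))}} 1ℚ
            , N , λ n N≤n → begin
      ∣ seq x n ∣                                    ≡⟨ cong ∣_∣ (eq (seq x n) (seq x N)) ⟩
      ∣ seq x N ℚ.+ (seq x n ℚ.- seq x N) ∣          ≤⟨ ℚ.∣p+q∣≤∣p∣+∣q∣ (seq x N) _ ⟩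
      ∣ seq x N ∣ ℚ.+ ∣ seq x n ℚ.- seq x N ∣        ≤⟨ ℚ.+-monoʳ-≤ ∣ seq x N ∣ (ℚ.<⇒≤ (p n N N≤n ℕ.≤-refl)) ⟩
      ∣ seq x N ∣ ℚ.+ 1ℚ                             ∎
    where
    open ℚ.≤-Reasoning
    N = proj₁ (cauchy x 1ℚ)
    p = proj₂ (cauchy x 1ℚ)
    eq : ∀ a b → a ≡ b ℚ.+ (a ℚ.- b)
    eq = solve 2 (λ a b → a := b :+ (a :- b)) refl where open +-*-Solver

  ≈⇒small : ∀ x y → x ≈ y → Small (λ m _ → seq x m ℚ.- seq y m)
  ≈⇒small _ _ e ε = let N , p = close e ε in N , λ m _ a _ → p m a

  small⇒≈ : ∀ x y → Small (λ m _ → seq x m ℚ.- seq y m) → x ≈ y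
  small⇒≈ _ _ s = mk≈ λ ε → let N , p = s ε in N , λ n a → p n n a a

  fst snd : ℕ → ℕ → ℕ
  fst m _ = m
  snd _ n = n

fromℚ : ℚ → ℝ
seq    (fromℚ q) _ = q
cauchy (fromℚ q)   = small-zero (λ _ _ → ℚ.+-inverseʳ q)

fromℕ : ℕ → ℝ
fromℕ n = fromℚ (ℤ.+ n ℚ./ 1)

0ℝ 1ℝ : ℝ
0ℝ = fromℚ 0ℚ
1ℝ = fromℚ 1ℚ

infixl 6 _+_
infixl 7 _*_
infix  8 -_

_+_ : ℝ → ℝ → ℝ
seq    (x + y) n = seq x n ℚ.+ seq y n
cauchy (x + y)   =
  small-cong 0 (λ m n _ _ → eq (seq x m) (seq x n) (seq y m) (seq y n))
    (small-+ (cauchy x) (cauchy y))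
  where
  eq : ∀ a b c d → (a ℚ.- b) ℚ.+ (c ℚ.- d) ≡ (a ℚ.+ c) ℚ.- (b ℚ.+ d)
  eq = solve 4 (λ a b c d → (a :- b) :+ (c :- d) := (a :+ c) :- (b :+ d)) refl
    where open +-*-Solver

-_ : ℝ → ℝ
seq    (- x) n = ℚ.- seq x n
cauchy (- x)   =
  small-cong 0 (λ m n _ _ → eq (seq x m) (seq x n)) (small-neg (cauchy x))
  where
  eq : ∀ a b → ℚ.- (a ℚ.- b) ≡ ℚ.- a ℚ.- ℚ.- b
  eq = solve 2 (λ a b → :- (a :- b) := :- a :- :- b) refl where open +-*-Solver

private
  *-difference : ∀ a b c d →
    a ℚ.* (c ℚ.- d) ℚ.+ d ℚ.* (a ℚ.- b) ≡ a ℚ.* c ℚ.- b ℚ.* d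
  *-difference = solve 4
    (λ a b c d → a :* (c :- d) :+ d :* (a :- b) := a :* c :- b :* d) refl
    where open +-*-Solver

_*_ : ℝ → ℝ → ℝ
seq    (x * y) n = seq x n ℚ.* seq y n
cauchy (x * y)   =
  small-cong 0 (λ m n _ _ → *-difference (seq x m) (seq x n) (seq y m) (seq y n))
    (small-+ (small-* fst (λ _ _ p _ → p) (bounded x) (cauchy y))
             (small-* snd (λ _ _ _ q → q) (bounded y) (cauchy x)))

-- If x is bounded below by ε > 0 from some index on, then the reciprocal
-- is represented by the sequence n ↦ 1 / max (xₙ, ε).
module Reciprocal (x : ℝ) (x>0 : 0ℝ < x) where
  private
    ε = proj₁ x>0
    N = proj₁ (proj₂ (proj₂ x>0))

    instance
      ε>0 : Positive ε
      ε>0 = proj₁ (proj₂ x>0)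

      ε≢0 : ℚ.NonZero ε
      ε≢0 = ℚ.pos⇒nonZero ε

    max : ℕ → ℚ
    max n = seq x n ⊔ ε

    instance
      max>0 : ∀ {n} → Positive (max n)
      max>0 {n} = ℚ.positive
        (ℚ.<-≤-trans (ℚ.positive⁻¹ ε) (ℚ.p≤q⊔p (seq x n) ε))

      max≢0 : ∀ {n} → ℚ.NonZero (max n)
      max≢0 {n} = ℚ.pos⇒nonZero (max n)

    rec : ℕ → ℚ
    rec n = ℚ.1/ max n

    max≡x : ∀ n → N ℕ.≤ n → max n ≡ seq x n
    max≡x n N≤n = ℚ.p≥q⇒p⊔q≡p (subst (ε ℚ.≤_) (ℚ.+-identityʳ (seq x n))
      (proj₂ (proj₂ (proj₂ x>0)) n N≤n))

    rec-inverse : ∀ n → N ℕ.≤ n → seq x n ℚ.* rec n ≡ 1ℚ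
    rec-inverse n N≤n =
      trans (cong (ℚ._* rec n) (sym (max≡x n N≤n))) (ℚ.*-inverseʳ (max n))

    rec-bounded : Bounded rec
    rec-bounded = ℚ.1/ ε , ℚ.1/pos⇒pos ε , 0 , λ n _ →
      let instance
            rec>0 : Positive (rec n)
            rec>0 = ℚ.1/pos⇒pos (max n)
            1/ε>0 : Positive (ℚ.1/ ε)
            1/ε>0 = ℚ.1/pos⇒pos ε
            rec≥0 : ℚ.NonNegative (rec n)
            rec≥0 = ℚ.pos⇒nonNeg (rec n)
            1/ε≥0 : ℚ.NonNegative (ℚ.1/ ε)
            1/ε≥0 = ℚ.pos⇒nonNeg (ℚ.1/ ε)
      in begin
      ∣ rec n ∣                      ≡⟨ ℚ.0≤p⇒∣p∣≡p (ℚ.<⇒≤ (ℚ.positive⁻¹ (rec n))) ⟩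
      rec n                          ≡⟨ ℚ.*-identityˡ (rec n) ⟨
      1ℚ ℚ.* rec n                   ≡⟨ cong (ℚ._* rec n) (ℚ.*-inverseˡ ε) ⟨
      ℚ.1/ ε ℚ.* ε ℚ.* rec n         ≡⟨ ℚ.*-assoc (ℚ.1/ ε) ε (rec n) ⟩
      ℚ.1/ ε ℚ.* (ε ℚ.* rec n)       ≤⟨ ℚ.*-monoˡ-≤-nonNeg (ℚ.1/ ε)
                                          (ℚ.*-monoʳ-≤-nonNeg (rec n) (ℚ.p≤q⊔p (seq x n) ε)) ⟩
      ℚ.1/ ε ℚ.* (max n ℚ.* rec n)   ≡⟨ cong (ℚ.1/ ε ℚ.*_) (ℚ.*-inverseʳ (max n)) ⟩
      ℚ.1/ ε ℚ.* 1ℚ                  ≡⟨ ℚ.*-identityʳ (ℚ.1/ ε) ⟩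
      ℚ.1/ ε                         ∎
      where open ℚ.≤-Reasoning

    rec-difference : ∀ m n → N ℕ.≤ m → N ℕ.≤ n →
      rec m ℚ.* (rec n ℚ.* (ℚ.- (seq x m ℚ.- seq x n))) ≡ rec m ℚ.- rec n
    rec-difference m n N≤m N≤n = begin
      rec m ℚ.* (rec n ℚ.* (ℚ.- (seq x m ℚ.- seq x n)))
        ≡⟨ eq (rec m) (rec n) (seq x m) (seq x n) ⟩
      seq x n ℚ.* rec n ℚ.* rec m ℚ.- seq x m ℚ.* rec m ℚ.* rec n
        ≡⟨ cong₂ (λ s t → s ℚ.* rec m ℚ.- t ℚ.* rec n) (rec-inverse n N≤n) (rec-inverse m N≤m) ⟩
      1ℚ ℚ.* rec m ℚ.- 1ℚ ℚ.* rec n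
        ≡⟨ cong₂ ℚ._-_ (ℚ.*-identityˡ (rec m)) (ℚ.*-identityˡ (rec n)) ⟩
      rec m ℚ.- rec n ∎
      where
      open ≡-Reasoning
      eq : ∀ r s a b → r ℚ.* (s ℚ.* (ℚ.- (a ℚ.- b))) ≡ b ℚ.* s ℚ.* r ℚ.- a ℚ.* r ℚ.* s
      eq = solve 4 (λ r s a b → r :* (s :* (:- (a :- b))) := b :* s :* r :- a :* r :* s) refl
        where open +-*-Solver

  reciprocal : ℝ
  seq    reciprocal = rec
  cauchy reciprocal = small-cong N rec-difference
    (small-* fst (λ _ _ p _ → p) rec-bounded
      (small-* snd (λ _ _ _ q → q) rec-bounded (small-neg (cauchy x))))

  *-reciprocal : x * reciprocal ≈ 1ℝ
  *-reciprocal = mk≈ λ δ → N , λ n N≤n →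
    subst (λ t → ∣ t ℚ.- 1ℚ ∣ ℚ.< δ) (sym (rec-inverse n N≤n)) (ℚ.positive⁻¹ δ)

open Reciprocal public using (reciprocal; *-reciprocal)

private
  pointwise : ∀ x y → (∀ n → seq x n ≡ seq y n) → x ≈ y
  pointwise x y e = small⇒≈ x y (small-zero λ m _ →
    trans (cong (ℚ._- seq y m) (e m)) (ℚ.+-inverseʳ (seq y m)))

≈-refl : ∀ {x} → x ≈ x
≈-refl {x} = pointwise x x (λ _ → refl)

≈-sym : ∀ {x y} → x ≈ y → y ≈ x
≈-sym {x} {y} e = small⇒≈ y x
  (small-cong 0 (λ m _ _ _ → eq (seq x m) (seq y m)) (small-neg (≈⇒small x y e)))
  where
  eq : ∀ a b → ℚ.- (a ℚ.- b) ≡ b ℚ.- a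
  eq = solve 2 (λ a b → :- (a :- b) := b :- a) refl where open +-*-Solver

≈-trans : ∀ {x y z} → x ≈ y → y ≈ z → x ≈ z
≈-trans {x} {y} {z} e f = small⇒≈ x z
  (small-cong 0 (λ m _ _ _ → eq (seq x m) (seq y m) (seq z m))
    (small-+ (≈⇒small x y e) (≈⇒small y z f)))
  where
  eq : ∀ a b c → (a ℚ.- b) ℚ.+ (b ℚ.- c) ≡ a ℚ.- c
  eq = solve 3 (λ a b c → (a :- b) :+ (b :- c) := a :- c) refl where open +-*-Solver

+-cong : ∀ {x x′ y y′} → x ≈ x′ → y ≈ y′ → x + y ≈ x′ + y′
+-cong {x} {x′} {y} {y′} e f = small⇒≈ (x + y) (x′ + y′)
  (small-cong 0 (λ m _ _ _ → eq (seq x m) (seq x′ m) (seq y m) (seq y′ m))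
    (small-+ (≈⇒small x x′ e) (≈⇒small y y′ f)))
  where
  eq : ∀ a b c d → (a ℚ.- b) ℚ.+ (c ℚ.- d) ≡ (a ℚ.+ c) ℚ.- (b ℚ.+ d)
  eq = solve 4 (λ a b c d → (a :- b) :+ (c :- d) := (a :+ c) :- (b :+ d)) refl
    where open +-*-Solver

-‿cong : ∀ {x y} → x ≈ y → - x ≈ - y
-‿cong {x} {y} e = small⇒≈ (- x) (- y)
  (small-cong 0 (λ m _ _ _ → eq (seq x m) (seq y m)) (small-neg (≈⇒small x y e)))
  where
  eq : ∀ a b → ℚ.- (a ℚ.- b) ≡ ℚ.- a ℚ.- ℚ.- b
  eq = solve 2 (λ a b → :- (a :- b) := :- a :- :- b) refl where open +-*-Solver

*-cong : ∀ {x x′ y y′} → x ≈ x′ → y ≈ y′ → x * y ≈ x′ * y′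
*-cong {x} {x′} {y} {y′} e f = small⇒≈ (x * y) (x′ * y′)
  (small-cong 0 (λ m _ _ _ → *-difference (seq x m) (seq x′ m) (seq y m) (seq y′ m))
    (small-+ (small-* fst (λ _ _ p _ → p) (bounded x) (≈⇒small y y′ f))
             (small-* fst (λ _ _ p _ → p) (bounded y′) (≈⇒small x x′ e))))

+-*-isCommutativeRing : IsCommutativeRing _≈_ _+_ _*_ -_ 0ℝ 1ℝ
+-*-isCommutativeRing = record
  { isRing = record
    { +-isAbelianGroup = record
      { isGroup = record
        { isMonoid = record
          { isSemigroup = record
            { isMagma = record
              { isEquivalence = record
                { refl = ≈-refl ; sym = ≈-sym ; trans = ≈-trans }
              ; ∙-cong = +-cong }
            ; assoc = λ x y z → pointwise ((x + y) + z) (x + (y + z))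
                        λ n → ℚ.+-assoc (seq x n) (seq y n) (seq z n) }
          ; identity = (λ x → pointwise (0ℝ + x) x λ n → ℚ.+-identityˡ (seq x n))
                     , (λ x → pointwise (x + 0ℝ) x λ n → ℚ.+-identityʳ (seq x n)) }
        ; inverse = (λ x → pointwise (- x + x) 0ℝ λ n → ℚ.+-inverseˡ (seq x n))
                  , (λ x → pointwise (x + - x) 0ℝ λ n → ℚ.+-inverseʳ (seq x n))
        ; ⁻¹-cong = -‿cong }
      ; comm = λ x y → pointwise (x + y) (y + x) λ n → ℚ.+-comm (seq x n) (seq y n) }
    ; *-cong = *-cong
    ; *-assoc = λ x y z → pointwise ((x * y) * z) (x * (y * z))
                  λ n → ℚ.*-assoc (seq x n) (seq y n) (seq z n)
    ; *-identity = (λ x → pointwise (1ℝ * x) x λ n → ℚ.*-identityˡ (seq x n))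
                 , (λ x → pointwise (x * 1ℝ) x λ n → ℚ.*-identityʳ (seq x n))
    ; distrib = (λ x y z → pointwise (x * (y + z)) (x * y + x * z)
                   λ n → ℚ.*-distribˡ-+ (seq x n) (seq y n) (seq z n))
              , (λ x y z → pointwise ((y + z) * x) (y * x + z * x)
                   λ n → ℚ.*-distribʳ-+ (seq x n) (seq y n) (seq z n)) }
  ; *-comm = λ x y → pointwise (x * y) (y * x) λ n → ℚ.*-comm (seq x n) (seq y n) }

ℝ-commutativeRing : CommutativeRing 0ℓ 0ℓ
ℝ-commutativeRing = record { isCommutativeRing = +-*-isCommutativeRing }

ℝ-rawRing : RawRing 0ℓ 0ℓ
ℝ-rawRing = CommutativeRing.rawRing ℝ-commutativeRing

-- Polynomials in one variable, as coefficient lists in ascending degree.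
-- Trailing zeros are allowed, so equality compares coefficients.

module Polynomial {c ℓ} (R : RawRing c ℓ) where
  open RawRing R renaming
    (Carrier to A; _≈_ to _≈ᴿ_; _+_ to _+ᴿ_; _*_ to _*ᴿ_; -_ to -ᴿ_; 0# to 0ᴿ; 1# to 1ᴿ)

  Poly : Set c
  Poly = List A

  coeff : Poly → ℕ → A
  coeff []      _       = 0ᴿ
  coeff (a ∷ _) zero    = a
  coeff (_ ∷ p) (suc i) = coeff p i

  infix  4 _≋_
  infixl 6 _⊕_
  infixl 7 _⊗_

  record _≋_ (p q : Poly) : Set ℓ where
    constructor mk≋
    field
      coeffs : ∀ i → coeff p i ≈ᴿ coeff q i

  _⊕_ : Poly → Poly → Poly
  []      ⊕ q       = q
  (a ∷ p) ⊕ []      = a ∷ p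
  (a ∷ p) ⊕ (b ∷ q) = a +ᴿ b ∷ p ⊕ q

  _⊗_ : Poly → Poly → Poly
  []      ⊗ q = []
  (a ∷ p) ⊗ q = List.map (a *ᴿ_) q ⊕ (0ᴿ ∷ p ⊗ q)

  const : A → Poly
  const a = a ∷ []

  X : Poly
  X = 0ᴿ ∷ 1ᴿ ∷ []

  rawRing : RawRing c ℓ
  rawRing = record
    { Carrier = Poly
    ; _≈_     = _≋_
    ; _+_     = _⊕_
    ; _*_     = _⊗_
    ; -_      = List.map -ᴿ_
    ; 0#      = []
    ; 1#      = const 1ᴿ
    }

module SquareMatrix {c ℓ} (R : RawRing c ℓ) where
  open RawRing R renaming
    (Carrier to A; _≈_ to _≈ᴿ_; _+_ to _+ᴿ_; _*_ to _*ᴿ_; -_ to -ᴿ_; 0# to 0ᴿ; 1# to 1ᴿ)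
  open RawMonoidDefinitions (RawRing.+-rawMonoid R) public using (sum)
  open RawSemiringDefinitions (RawRing.rawSemiring R) using (_^_)

  Matrix : ℕ → Set c
  Matrix n = Fin n → Fin n → A

  infix  4 _≈ᴹ_
  infixl 6 _-ᴹ_
  infixl 7 _*ᴹ_ _·ᴹ_

  _≈ᴹ_ : ∀ {n} → Matrix n → Matrix n → Set ℓ
  M ≈ᴹ N = ∀ i j → M i j ≈ᴿ N i j

  _-ᴹ_ : ∀ {n} → Matrix n → Matrix n → Matrix n
  (M -ᴹ N) i j = M i j +ᴿ (-ᴿ N i j)

  _*ᴹ_ : ∀ {n} → Matrix n → Matrix n → Matrix n
  (M *ᴹ N) i j = sum λ k → M i k *ᴿ N k j

  _·ᴹ_ : ∀ {n} → A → Matrix n → Matrix n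
  (a ·ᴹ M) i j = a *ᴿ M i j

  diag : ∀ {n} → Vector A n → Matrix n
  diag a i j = if does (i Fin.≟ j) then a i else 0ᴿ

  1ᴹ : ∀ {n} → Matrix n
  1ᴹ = diag λ _ → 1ᴿ

  -- Laplace expansion along the first row.
  det : ∀ {n} → Matrix n → A
  det {zero}  _ = 1ᴿ
  det {suc n} M = sum λ j →
    (-ᴿ 1ᴿ) ^ toℕ j *ᴿ M zero j *ᴿ det (λ i k → M (suc i) (punchIn j k))

σ : ℕ → ℕ
σ k = sumℕ (List.filter (_∣? k) (List.applyUpTo suc k))

open Polynomial ℝ-rawRing public using (Poly; X; const; coeff)

ℝ[X] : RawRing 0ℓ 0ℓ
ℝ[X] = Polynomial.rawRing ℝ-rawRing

open RawRing ℝ[X] public using ()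
  renaming (_≈_ to _≈ₚ_; _+_ to _+ₚ_; _*_ to _*ₚ_; -_ to -ₚ_; 0# to 0ₚ; 1# to 1ₚ)

module Matℝ = SquareMatrix ℝ-rawRing
module Matℝ[X] = SquareMatrix ℝ[X]

module D'Arcais
  (h : (n : ℕ) .{{_ : NonZero n}} → ℝ)
  (h>0 : ∀ n .{{_ : NonZero n}} → 0ℝ < h n) where

  h⁻¹ : (n : ℕ) .{{_ : NonZero n}} → ℝ
  h⁻¹ n = reciprocal (h n) (h>0 n)

  -- Course-of-values recursion: history n = Pₙ ∷ Pₙ₋₁ ∷ … ∷ P₀.  The
  -- summation index k of the recurrence is suc (toℕ i) below.
  history : ∀ n → Vec Poly (suc n)
  history zero    = 1ₚ ∷ []
  history (suc n) =
    X *ₚ const (h⁻¹ (suc n)) *ₚ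
      Matℝ[X].sum (λ i → const (fromℕ (σ (suc (toℕ i)))) *ₚ Vec.lookup (history n) i)
    ∷ history n

  P : ℕ → Poly
  P n = Vec.head (history n)

  lookup-history : ∀ n i → Vec.lookup (history n) i ≡ P (n ∸ toℕ i)
  lookup-history zero    zero    = refl
  lookup-history (suc n) zero    = refl
  lookup-history (suc n) (suc i) = lookup-history n i

  -- Row and column indices i, j : Fin n stand for i + 1 and j + 1.  That H⁻¹
  -- is the inverse matrix of H is H-inverseˡ and H-inverseʳ below.

  H H⁻¹ L U : ∀ n → Matℝ.Matrix n
  H   n = Matℝ.diag λ i → h (suc (toℕ i))
  H⁻¹ n = Matℝ.diag λ i → h⁻¹ (suc (toℕ i))
  L n i j = if does (toℕ j ℕ.≤? toℕ i) then fromℕ (σ (suc (toℕ i ∸ toℕ j))) else 0ℝ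
  U n i j = if does (toℕ j ℕ.≟ suc (toℕ i)) then 1ℝ else 0ℝ

constᴹ : ∀ {n} → Matℝ.Matrix n → Matℝ[X].Matrix n
constᴹ M i j = const (M i j)

private
  module DiagonalInverse {c ℓ} (R : CommutativeRing c ℓ) where
    open CommutativeRing R using (Carrier; 0#; 1#; +-congˡ; +-identityˡ; +-identityʳ; zeroˡ; zeroʳ)
      renaming (_≈_ to _≈ᴿ_; _*_ to _*ᴿ_; refl to reflᴿ; trans to transᴿ; +-cong to +ᴿ-cong)
    open SquareMatrix (CommutativeRing.rawRing R)

    sum-0* : ∀ {n} (v : Vector Carrier n) → sum (λ k → 0# *ᴿ v k) ≈ᴿ 0#
    sum-0* {zero}  v = reflᴿ
    sum-0* {suc n} v = transᴿ (+ᴿ-cong (zeroˡ _) (sum-0* (λ k → v (suc k)))) (+-identityˡ 0#)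

    sum-diag : ∀ {n} (a v : Vector Carrier n) i → sum (λ k → diag a i k *ᴿ v k) ≈ᴿ a i *ᴿ v i
    sum-diag a v zero    = transᴿ (+-congˡ (sum-0* (λ k → v (suc k)))) (+-identityʳ _)
    sum-diag a v (suc i) = transᴿ
      (+ᴿ-cong (zeroˡ _) (sum-diag (λ k → a (suc k)) (λ k → v (suc k)) i)) (+-identityˡ _)

    scale-diag : ∀ {n} (a b : Vector Carrier n) → (∀ i → a i *ᴿ b i ≈ᴿ 1#) →
                 ∀ i j → a i *ᴿ diag b i j ≈ᴿ 1ᴹ i j
    scale-diag a b ab≈1 zero    zero    = ab≈1 zero
    scale-diag a b ab≈1 zero    (suc j) = zeroʳ _
    scale-diag a b ab≈1 (suc i) zero    = zeroʳ _
    scale-diag a b ab≈1 (suc i) (suc j) =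
      scale-diag (λ k → a (suc k)) (λ k → b (suc k)) (λ k → ab≈1 (suc k)) i j

    diag-inverse : ∀ {n} (a b : Vector Carrier n) → (∀ i → a i *ᴿ b i ≈ᴿ 1#) →
                   diag a *ᴹ diag b ≈ᴹ 1ᴹ
    diag-inverse a b ab≈1 i j = transᴿ (sum-diag a (λ k → diag b k j) i) (scale-diag a b ab≈1 i j)

module _ (h : (n : ℕ) .{{_ : NonZero n}} → ℝ)
         (h>0 : ∀ n .{{_ : NonZero n}} → 0ℝ < h n) where
  open D'Arcais h h>0
  open DiagonalInverse ℝ-commutativeRing using (diag-inverse)

  H-inverseʳ : ∀ n → H n Matℝ.*ᴹ H⁻¹ n Matℝ.≈ᴹ Matℝ.1ᴹ
  H-inverseʳ n = diag-inverse (λ i → h (suc (toℕ i))) (λ i → h⁻¹ (suc (toℕ i)))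
    λ i → *-reciprocal (h (suc (toℕ i))) (h>0 (suc (toℕ i)))

  H-inverseˡ : ∀ n → H⁻¹ n Matℝ.*ᴹ H n Matℝ.≈ᴹ Matℝ.1ᴹ
  H-inverseˡ n = diag-inverse (λ i → h⁻¹ (suc (toℕ i))) (λ i → h (suc (toℕ i)))
    λ i → let x = h (suc (toℕ i)); y = h⁻¹ (suc (toℕ i)) in
      ≈-trans
        (CommutativeRing.*-comm ℝ-commutativeRing y x)
        (*-reciprocal x (h>0 (suc (toℕ i))))

{-# OPTIONS --safe #-}
module Submission where

-- The matrix is lower Hessenberg with superdiagonal entries −1, and for such
-- matrices expanding the determinant along the last row gives
-- det Mₙ₊₁ = Σⱼ Mₙⱼ det Mⱼ over the leading principal minors, where
-- 0 ≤ j ≤ n.  With Mₙⱼ = z σ(n − j + 1) / h(n + 1) this is the recurrence of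
-- the polynomials, read backwards.  As det expands along the first row, the
-- last-row expansion is proved by induction on the size: the two minors that
-- survive in the first row are again Hessenberg of the same kind.

open import Algebra.Bundles using (CommutativeRing)
open import Algebra.Bundles.Raw using (module RawRing)
import Algebra.Consequences.Setoid as Consequences
import Algebra.Definitions.RawSemiring as RawSemiringDefinitions
import Algebra.Properties.CommutativeSemigroup as CommutativeSemigroupProperties
import Algebra.Properties.CommutativeMonoid.Sum as CommutativeMonoidSum
import Algebra.Properties.Ring as RingProperties
import Algebra.Properties.Semiring.Sum as SemiringSum
open import Data.Bool.Base using (if_then_else_)
open import Data.Fin.Base using (Fin; zero; suc; toℕ; punchIn; opposite)
open import Data.Fin.Permutation using (reverse)
import Data.Fin.Properties as Fin
open import Data.List.Base as List using ([]; _∷_)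
open import Data.Nat.Base as ℕ using (ℕ; zero; suc; _∸_; NonZero; z<s; s<s)
open import Data.Nat.Induction using (<-rec)
import Data.Nat.Properties as ℕ
open import Data.Product.Base using (_,_)
open import Data.Vec.Functional using (Vector)
open import Relation.Binary.Bundles using (Setoid)
open import Relation.Binary.PropositionalEquality as ≡ using (_≡_)
import Relation.Binary.Reasoning.Setoid as ≈-Reasoning
open import Relation.Nullary.Decidable using (dec-true; dec-false)
open import Relation.Nullary.Decidable.Core using (does)
open import Defs using (module Polynomial; module SquareMatrix)

-- The commutative ring of polynomials, by comparison of coefficients.

module PolynomialRing {c ℓ} (R : CommutativeRing c ℓ) where
  open CommutativeRing R hiding (zero)
  open Polynomial rawRing hiding (rawRing)
  open ≈-Reasoning setoid
  open RingProperties ring using (-0#≈0#)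
  open CommutativeSemigroupProperties +-commutativeSemigroup using (interchange; x∙yz≈y∙xz)

  coeff-⊕ : ∀ p q i → coeff (p ⊕ q) i ≈ coeff p i + coeff q i
  coeff-⊕ []      q       i       = sym (+-identityˡ _)
  coeff-⊕ (a ∷ p) []      i       = sym (+-identityʳ _)
  coeff-⊕ (a ∷ p) (b ∷ q) zero    = refl
  coeff-⊕ (a ∷ p) (b ∷ q) (suc i) = coeff-⊕ p q i

  coeff-neg : ∀ p i → coeff (List.map -_ p) i ≈ - coeff p i
  coeff-neg []      i       = sym -0#≈0#
  coeff-neg (a ∷ p) zero    = refl
  coeff-neg (a ∷ p) (suc i) = coeff-neg p i

  coeff-scale : ∀ a p i → coeff (List.map (a *_) p) i ≈ a * coeff p i
  coeff-scale a []      i       = sym (zeroʳ a)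
  coeff-scale a (b ∷ p) zero    = refl
  coeff-scale a (b ∷ p) (suc i) = coeff-scale a p i

  coeff-∷⊗-zero : ∀ a p q → coeff ((a ∷ p) ⊗ q) 0 ≈ a * coeff q 0
  coeff-∷⊗-zero a p q = begin
    coeff ((a ∷ p) ⊗ q) 0                ≈⟨ coeff-⊕ (List.map (a *_) q) (0# ∷ p ⊗ q) 0 ⟩
    coeff (List.map (a *_) q) 0 + 0#     ≈⟨ +-identityʳ _ ⟩
    coeff (List.map (a *_) q) 0          ≈⟨ coeff-scale a q 0 ⟩
    a * coeff q 0                        ∎

  coeff-∷⊗-suc : ∀ a p q i →
    coeff ((a ∷ p) ⊗ q) (suc i) ≈ a * coeff q (suc i) + coeff (p ⊗ q) i
  coeff-∷⊗-suc a p q i =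
    trans (coeff-⊕ (List.map (a *_) q) (0# ∷ p ⊗ q) (suc i))
          (+-congʳ (coeff-scale a q (suc i)))

  -- `_⊗_` recurses on its left factor. This and `coeff-⊗∷-suc` give the mirrored recursion on the
  -- right factor, which is what commutativity needs.
  coeff-⊗∷-zero : ∀ p b q → coeff (p ⊗ (b ∷ q)) 0 ≈ coeff p 0 * b
  coeff-⊗∷-zero []      b q = sym (zeroˡ b)
  coeff-⊗∷-zero (a ∷ p) b q = coeff-∷⊗-zero a p (b ∷ q)

  coeff-⊗∷-suc : ∀ p b q i →
    coeff (p ⊗ (b ∷ q)) (suc i) ≈ coeff p (suc i) * b + coeff (p ⊗ q) i
  coeff-⊗∷-suc []      b q i = sym (trans (+-identityʳ _) (zeroˡ b))
  coeff-⊗∷-suc (a ∷ p) b q zero = begin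
    coeff ((a ∷ p) ⊗ (b ∷ q)) 1               ≈⟨ coeff-∷⊗-suc a p (b ∷ q) 0 ⟩
    a * coeff q 0 + coeff (p ⊗ (b ∷ q)) 0     ≈⟨ +-cong (sym (coeff-∷⊗-zero a p q)) (coeff-⊗∷-zero p b q) ⟩
    coeff ((a ∷ p) ⊗ q) 0 + coeff p 0 * b     ≈⟨ +-comm _ _ ⟩
    coeff p 0 * b + coeff ((a ∷ p) ⊗ q) 0     ∎
  coeff-⊗∷-suc (a ∷ p) b q (suc i) = begin
    coeff ((a ∷ p) ⊗ (b ∷ q)) (suc (suc i))
      ≈⟨ coeff-∷⊗-suc a p (b ∷ q) (suc i) ⟩
    a * coeff q (suc i) + coeff (p ⊗ (b ∷ q)) (suc i)
      ≈⟨ +-congˡ (coeff-⊗∷-suc p b q i) ⟩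
    a * coeff q (suc i) + (coeff p (suc i) * b + coeff (p ⊗ q) i)
      ≈⟨ x∙yz≈y∙xz _ _ _ ⟩
    coeff p (suc i) * b + (a * coeff q (suc i) + coeff (p ⊗ q) i)
      ≈⟨ +-congˡ (coeff-∷⊗-suc a p q i) ⟨
    coeff p (suc i) * b + coeff ((a ∷ p) ⊗ q) (suc i)
      ∎

  coeff-⊗-[] : ∀ p i → coeff (p ⊗ []) i ≈ 0#
  coeff-⊗-[] []      i       = refl
  coeff-⊗-[] (a ∷ p) zero    = refl
  coeff-⊗-[] (a ∷ p) (suc i) = coeff-⊗-[] p i

  -- Induction on the right factor: the right recursion for `p ⊗ (b ∷ q)` and the left recursion for
  -- `(b ∷ q) ⊗ p` agree term by term, up to commutativity of the coefficients.
  coeff-⊗-comm : ∀ p q i → coeff (p ⊗ q) i ≈ coeff (q ⊗ p) i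
  coeff-⊗-comm p []      i       = coeff-⊗-[] p i
  coeff-⊗-comm p (b ∷ q) zero    = begin
    coeff (p ⊗ (b ∷ q)) 0   ≈⟨ coeff-⊗∷-zero p b q ⟩
    coeff p 0 * b           ≈⟨ *-comm _ _ ⟩
    b * coeff p 0           ≈⟨ coeff-∷⊗-zero b q p ⟨
    coeff ((b ∷ q) ⊗ p) 0   ∎
  coeff-⊗-comm p (b ∷ q) (suc i) = begin
    coeff (p ⊗ (b ∷ q)) (suc i)             ≈⟨ coeff-⊗∷-suc p b q i ⟩
    coeff p (suc i) * b + coeff (p ⊗ q) i   ≈⟨ +-cong (*-comm _ _) (coeff-⊗-comm p q i) ⟩
    b * coeff p (suc i) + coeff (q ⊗ p) i   ≈⟨ coeff-∷⊗-suc b q p i ⟨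
    coeff ((b ∷ q) ⊗ p) (suc i)             ∎

  coeff-⊗-congˡ : ∀ p {q r} → q ≋ r → ∀ i → coeff (p ⊗ q) i ≈ coeff (p ⊗ r) i
  coeff-⊗-congˡ []      q≋r i = refl
  coeff-⊗-congˡ (a ∷ p) {q} {r} q≋r zero = begin
    coeff ((a ∷ p) ⊗ q) 0   ≈⟨ coeff-∷⊗-zero a p q ⟩
    a * coeff q 0           ≈⟨ *-congˡ (_≋_.coeffs q≋r 0) ⟩
    a * coeff r 0           ≈⟨ coeff-∷⊗-zero a p r ⟨
    coeff ((a ∷ p) ⊗ r) 0   ∎
  coeff-⊗-congˡ (a ∷ p) {q} {r} q≋r (suc i) = begin
    coeff ((a ∷ p) ⊗ q) (suc i)             ≈⟨ coeff-∷⊗-suc a p q i ⟩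
    a * coeff q (suc i) + coeff (p ⊗ q) i   ≈⟨ +-cong (*-congˡ (_≋_.coeffs q≋r (suc i))) (coeff-⊗-congˡ p q≋r i) ⟩
    a * coeff r (suc i) + coeff (p ⊗ r) i   ≈⟨ coeff-∷⊗-suc a p r i ⟨
    coeff ((a ∷ p) ⊗ r) (suc i)             ∎

  coeff-⊗-distribˡ : ∀ p q r i →
    coeff (p ⊗ (q ⊕ r)) i ≈ coeff (p ⊗ q) i + coeff (p ⊗ r) i
  coeff-⊗-distribˡ []      q r i = sym (+-identityˡ 0#)
  coeff-⊗-distribˡ (a ∷ p) q r zero = begin
    coeff ((a ∷ p) ⊗ (q ⊕ r)) 0                      ≈⟨ coeff-∷⊗-zero a p (q ⊕ r) ⟩
    a * coeff (q ⊕ r) 0                              ≈⟨ *-congˡ (coeff-⊕ q r 0) ⟩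
    a * (coeff q 0 + coeff r 0)                      ≈⟨ distribˡ a _ _ ⟩
    a * coeff q 0 + a * coeff r 0                    ≈⟨ +-cong (coeff-∷⊗-zero a p q) (coeff-∷⊗-zero a p r) ⟨
    coeff ((a ∷ p) ⊗ q) 0 + coeff ((a ∷ p) ⊗ r) 0    ∎
  coeff-⊗-distribˡ (a ∷ p) q r (suc i) = begin
    coeff ((a ∷ p) ⊗ (q ⊕ r)) (suc i)
      ≈⟨ coeff-∷⊗-suc a p (q ⊕ r) i ⟩
    a * coeff (q ⊕ r) (suc i) + coeff (p ⊗ (q ⊕ r)) i
      ≈⟨ +-cong (trans (*-congˡ (coeff-⊕ q r (suc i))) (distribˡ a _ _)) (coeff-⊗-distribˡ p q r i) ⟩
    (a * coeff q (suc i) + a * coeff r (suc i)) + (coeff (p ⊗ q) i + coeff (p ⊗ r) i)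
      ≈⟨ interchange _ _ _ _ ⟩
    (a * coeff q (suc i) + coeff (p ⊗ q) i) + (a * coeff r (suc i) + coeff (p ⊗ r) i)
      ≈⟨ +-cong (coeff-∷⊗-suc a p q i) (coeff-∷⊗-suc a p r i) ⟨
    coeff ((a ∷ p) ⊗ q) (suc i) + coeff ((a ∷ p) ⊗ r) (suc i)
      ∎

  coeff-scale-⊗ : ∀ a p q i → coeff (List.map (a *_) p ⊗ q) i ≈ a * coeff (p ⊗ q) i
  coeff-scale-⊗ a []      q i = sym (zeroʳ a)
  coeff-scale-⊗ a (b ∷ p) q zero = begin
    coeff ((a * b ∷ List.map (a *_) p) ⊗ q) 0   ≈⟨ coeff-∷⊗-zero (a * b) (List.map (a *_) p) q ⟩
    a * b * coeff q 0                           ≈⟨ *-assoc a b _ ⟩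
    a * (b * coeff q 0)                         ≈⟨ *-congˡ (coeff-∷⊗-zero b p q) ⟨
    a * coeff ((b ∷ p) ⊗ q) 0                   ∎
  coeff-scale-⊗ a (b ∷ p) q (suc i) = begin
    coeff ((a * b ∷ List.map (a *_) p) ⊗ q) (suc i)
      ≈⟨ coeff-∷⊗-suc (a * b) (List.map (a *_) p) q i ⟩
    a * b * coeff q (suc i) + coeff (List.map (a *_) p ⊗ q) i
      ≈⟨ +-cong (*-assoc a b _) (coeff-scale-⊗ a p q i) ⟩
    a * (b * coeff q (suc i)) + a * coeff (p ⊗ q) i
      ≈⟨ distribˡ a _ _ ⟨
    a * (b * coeff q (suc i) + coeff (p ⊗ q) i)
      ≈⟨ *-congˡ (coeff-∷⊗-suc b p q i) ⟨
    a * coeff ((b ∷ p) ⊗ q) (suc i)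
      ∎

  coeff-0∷⊗ : ∀ p q i → coeff ((0# ∷ p) ⊗ q) i ≈ coeff (0# ∷ p ⊗ q) i
  coeff-0∷⊗ p q zero    = trans (coeff-∷⊗-zero 0# p q) (zeroˡ _)
  coeff-0∷⊗ p q (suc i) =
    trans (coeff-∷⊗-suc 0# p q i) (trans (+-congʳ (zeroˡ _)) (+-identityˡ _))

  coeff-∷-cong : ∀ a {p q} → (∀ i → coeff p i ≈ coeff q i) →
                 ∀ i → coeff (a ∷ p) i ≈ coeff (a ∷ q) i
  coeff-∷-cong a p≈q zero    = refl
  coeff-∷-cong a p≈q (suc i) = p≈q i

  coeff-⊗-distribʳ : ∀ r p q i →
    coeff ((p ⊕ q) ⊗ r) i ≈ coeff (p ⊗ r) i + coeff (q ⊗ r) i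
  coeff-⊗-distribʳ r p q i = begin
    coeff ((p ⊕ q) ⊗ r) i                ≈⟨ coeff-⊗-comm (p ⊕ q) r i ⟩
    coeff (r ⊗ (p ⊕ q)) i                ≈⟨ coeff-⊗-distribˡ r p q i ⟩
    coeff (r ⊗ p) i + coeff (r ⊗ q) i    ≈⟨ +-cong (coeff-⊗-comm r p i) (coeff-⊗-comm r q i) ⟩
    coeff (p ⊗ r) i + coeff (q ⊗ r) i    ∎

  -- The product `(a ∷ p) ⊗ q` is a scaled copy of `q` plus a shifted copy of `p ⊗ q`. Scaling and
  -- shifting both commute with multiplication by `r`, and the induction hypothesis applies under
  -- the shift.
  coeff-⊗-assoc : ∀ p q r i → coeff ((p ⊗ q) ⊗ r) i ≈ coeff (p ⊗ (q ⊗ r)) i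
  coeff-⊗-assoc []      q r i = refl
  coeff-⊗-assoc (a ∷ p) q r i = begin
    coeff ((List.map (a *_) q ⊕ (0# ∷ p ⊗ q)) ⊗ r) i
      ≈⟨ coeff-⊗-distribʳ r (List.map (a *_) q) (0# ∷ p ⊗ q) i ⟩
    coeff (List.map (a *_) q ⊗ r) i + coeff ((0# ∷ p ⊗ q) ⊗ r) i
      ≈⟨ +-cong (trans (coeff-scale-⊗ a q r i) (sym (coeff-scale a (q ⊗ r) i)))
                (trans (coeff-0∷⊗ (p ⊗ q) r i) (coeff-∷-cong 0# (coeff-⊗-assoc p q r) i)) ⟩
    coeff (List.map (a *_) (q ⊗ r)) i + coeff (0# ∷ p ⊗ (q ⊗ r)) i
      ≈⟨ coeff-⊕ (List.map (a *_) (q ⊗ r)) (0# ∷ p ⊗ (q ⊗ r)) i ⟨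
    coeff ((a ∷ p) ⊗ (q ⊗ r)) i
      ∎

  coeff-⊗-identityˡ : ∀ p i → coeff (const 1# ⊗ p) i ≈ coeff p i
  coeff-⊗-identityˡ p zero    = trans (coeff-∷⊗-zero 1# [] p) (*-identityˡ _)
  coeff-⊗-identityˡ p (suc i) =
    trans (coeff-∷⊗-suc 1# [] p i) (trans (+-identityʳ _) (*-identityˡ _))

  -- Ring structure up to equality of coefficients.

  ≋-setoid : Setoid c ℓ
  ≋-setoid = record
    { _≈_ = _≋_
    ; isEquivalence = record
      { refl  = mk≋ λ i → refl
      ; sym   = λ (mk≋ e) → mk≋ λ i → sym (e i)
      ; trans = λ (mk≋ e) (mk≋ f) → mk≋ λ i → trans (e i) (f i) } }

  open Setoid ≋-setoid using () renaming (trans to ≋-trans)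

  ⊕-cong : ∀ {p p′ q q′} → p ≋ p′ → q ≋ q′ → p ⊕ q ≋ p′ ⊕ q′
  ⊕-cong {p} {p′} {q} {q′} (mk≋ e) (mk≋ f) = mk≋ λ i →
    trans (coeff-⊕ p q i) (trans (+-cong (e i) (f i)) (sym (coeff-⊕ p′ q′ i)))

  ⊕-comm : ∀ p q → p ⊕ q ≋ q ⊕ p
  ⊕-comm p q = mk≋ λ i →
    trans (coeff-⊕ p q i) (trans (+-comm _ _) (sym (coeff-⊕ q p i)))

  ⊕-assoc : ∀ p q r → (p ⊕ q) ⊕ r ≋ p ⊕ (q ⊕ r)
  ⊕-assoc p q r = mk≋ λ i → begin
    coeff ((p ⊕ q) ⊕ r) i                   ≈⟨ coeff-⊕ (p ⊕ q) r i ⟩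
    coeff (p ⊕ q) i + coeff r i             ≈⟨ +-congʳ (coeff-⊕ p q i) ⟩
    (coeff p i + coeff q i) + coeff r i     ≈⟨ +-assoc _ _ _ ⟩
    coeff p i + (coeff q i + coeff r i)     ≈⟨ +-congˡ (coeff-⊕ q r i) ⟨
    coeff p i + coeff (q ⊕ r) i             ≈⟨ coeff-⊕ p (q ⊕ r) i ⟨
    coeff (p ⊕ (q ⊕ r)) i                   ∎

  ⊕-inverseʳ : ∀ p → p ⊕ List.map -_ p ≋ []
  ⊕-inverseʳ p = mk≋ λ i → trans (coeff-⊕ p (List.map -_ p) i)
    (trans (+-congˡ (coeff-neg p i)) (-‿inverseʳ (coeff p i)))

  neg-cong : ∀ {p q} → p ≋ q → List.map -_ p ≋ List.map -_ q
  neg-cong {p} {q} (mk≋ e) = mk≋ λ i →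
    trans (coeff-neg p i) (trans (-‿cong (e i)) (sym (coeff-neg q i)))

  ⊗-comm : ∀ p q → p ⊗ q ≋ q ⊗ p
  ⊗-comm p q = mk≋ (coeff-⊗-comm p q)

  ⊗-congˡ : ∀ p {q r} → q ≋ r → p ⊗ q ≋ p ⊗ r
  ⊗-congˡ p e = mk≋ (coeff-⊗-congˡ p e)

  -- Equal polynomials may be lists of different lengths, so a change of the left factor, on which
  -- `_⊗_` recurses, is moved to the right by commutativity.
  ⊗-cong : ∀ {p p′ q q′} → p ≋ p′ → q ≋ q′ → p ⊗ q ≋ p′ ⊗ q′
  ⊗-cong {p} {p′} {q} {q′} e f = ≋-trans (⊗-congˡ p f)
    (≋-trans (⊗-comm p q′) (≋-trans (⊗-congˡ q′ e) (⊗-comm q′ p′)))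

  ⊗-identityˡ : ∀ p → const 1# ⊗ p ≋ p
  ⊗-identityˡ p = mk≋ (coeff-⊗-identityˡ p)

  polynomialRing : CommutativeRing c ℓ
  polynomialRing = record
    { isCommutativeRing = record
      { isRing = record
        { +-isAbelianGroup = record
          { isGroup = record
            { isMonoid = record
              { isSemigroup = record
                { isMagma = record
                  { isEquivalence = Setoid.isEquivalence ≋-setoid
                  ; ∙-cong = ⊕-cong }
                ; assoc = ⊕-assoc }
              ; identity = comm∧idˡ⇒id ⊕-comm (λ p → mk≋ λ i → refl) }
            ; inverse = comm∧invʳ⇒inv ⊕-comm ⊕-inverseʳ
            ; ⁻¹-cong = neg-cong }
          ; comm = ⊕-comm }
        ; *-cong = ⊗-cong
        ; *-assoc = λ p q r → mk≋ (coeff-⊗-assoc p q r)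
        ; *-identity = comm∧idˡ⇒id ⊗-comm {const 1#} ⊗-identityˡ
        ; distrib =
            (λ p q r → mk≋ λ i → trans (coeff-⊗-distribˡ p q r i) (sym (coeff-⊕ (p ⊗ q) (p ⊗ r) i)))
          , (λ r p q → mk≋ λ i → trans (coeff-⊗-distribʳ r p q i) (sym (coeff-⊕ (p ⊗ r) (q ⊗ r) i))) }
      ; *-comm = ⊗-comm } }
    where open Consequences ≋-setoid

  const-cong : ∀ {a b} → a ≈ b → const a ≋ const b
  const-cong a≈b = mk≋ λ { zero → a≈b ; (suc i) → refl }

  -- The zero of the ring is the empty list, whereas `const 0#` has a trailing zero; hence equality
  -- only up to `_≋_`.
  const-0 : const 0# ≋ []
  const-0 = mk≋ λ { zero → refl ; (suc i) → refl }

  const-* : ∀ a b → const (a * b) ≋ const a ⊗ const b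
  const-* a b = mk≋ λ { zero → sym (+-identityʳ (a * b)) ; (suc i) → refl }

-- Left multiplication by a diagonal matrix.

module DiagonalProduct {c ℓ} (R : CommutativeRing c ℓ) where
  open CommutativeRing R hiding (zero)
  open SquareMatrix rawRing
  open CommutativeMonoidSum +-commutativeMonoid using (sum-cong-≋; sum-replicate-zero)

  -- Only the term `k = i` of the matrix product survives. This gives the entries of `H⁻¹ L`.
  diag-*ᴹ : ∀ {n} (a : Vector Carrier n) (M : Matrix n) i j → (diag a *ᴹ M) i j ≈ a i * M i j
  diag-*ᴹ a M i j = sum-diag a (λ k → M k j) i
    where
    sum-diag : ∀ {n} (a v : Vector Carrier n) i → sum (λ k → diag a i k * v k) ≈ a i * v i
    sum-diag {suc n} a v zero    = trans
      (+-congˡ (trans (sum-cong-≋ {n} λ k → zeroˡ (v (suc k))) (sum-replicate-zero n)))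
      (+-identityʳ _)
    sum-diag {suc n} a v (suc i) = trans
      (+-cong (zeroˡ _) (sum-diag (λ k → a (suc k)) (λ k → v (suc k)) i))
      (+-identityˡ _)

-- Determinants of lower Hessenberg matrices with superdiagonal -1.

module Hessenberg {c ℓ} (R : CommutativeRing c ℓ) where
  open CommutativeRing R hiding (zero)
  open SquareMatrix rawRing
  open RawSemiringDefinitions (RawRing.rawSemiring rawRing) using (_^_)
  open CommutativeMonoidSum +-commutativeMonoid
    using (sum-cong-≋; sum-replicate-zero; ∑-distrib-+)
  open SemiringSum semiring using (*-distribˡ-sum)
  open RingProperties ring using (-‿distribˡ-*; -‿involutive)
  open CommutativeSemigroupProperties *-commutativeSemigroup using (x∙yz≈y∙xz)
  open CommutativeSemigroupProperties +-commutativeSemigroup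
    using () renaming (x∙yz≈y∙xz to x+[y+z]≈y+[x+z])
  open ≈-Reasoning setoid

  det-cong : ∀ {n} {M N : Matrix n} → M ≈ᴹ N → det M ≈ det N
  det-cong {zero}  M≈N = refl
  det-cong {suc n} M≈N = sum-cong-≋ {suc n} λ j →
    *-cong (*-congˡ {(- 1#) ^ toℕ j} (M≈N zero j)) (det-cong λ i k → M≈N (suc i) (punchIn j k))

  -- Infinite matrices, so that leading principal minors need no casts.
  Matrix∞ : Set c
  Matrix∞ = ℕ → ℕ → Carrier

  leading : Matrix∞ → ∀ n → Matrix n
  leading f n i j = f (toℕ i) (toℕ j)

  record IsHessenberg (f : Matrix∞) : Set ℓ where
    field
      superdiagonal : ∀ i → f i (suc i) ≈ - 1#
      above         : ∀ i j → suc i ℕ.< j → f i j ≈ 0#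

  -- The size-free form of `punchIn (suc zero)`: it enumerates the columns other than column 1.
  omit₁ : ℕ → ℕ
  omit₁ zero    = zero
  omit₁ (suc j) = suc (suc j)

  toℕ-punchIn₁ : ∀ {n} (j : Fin (suc n)) → toℕ (punchIn (suc zero) j) ≡ omit₁ (toℕ j)
  toℕ-punchIn₁ zero    = ≡.refl
  toℕ-punchIn₁ (suc j) = ≡.refl

  minor₀ minor₁ : Matrix∞ → Matrix∞
  minor₀ f i j = f (suc i) (suc j)
  minor₁ f i j = f (suc i) (omit₁ j)

  minor₀-isHessenberg : ∀ {f} → IsHessenberg f → IsHessenberg (minor₀ f)
  minor₀-isHessenberg H = record
    { superdiagonal = λ i → superdiagonal (suc i)
    ; above         = λ i j i<j → above (suc i) (suc j) (s<s i<j) }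
    where open IsHessenberg H

  -- Past column 0, rows and columns are shifted alike, so the superdiagonal of `f` is kept; column
  -- 0 has no entry on or above the superdiagonal.
  minor₁-isHessenberg : ∀ {f} → IsHessenberg f → IsHessenberg (minor₁ f)
  minor₁-isHessenberg H = record
    { superdiagonal = λ i → superdiagonal (suc i)
    ; above         = λ { i (suc j) i<j → above (suc i) (suc (suc j)) (s<s i<j) } }
    where open IsHessenberg H

  -- The cofactor of the entry (0, 1), which is absent in size 1.
  cofactor₁ : Matrix∞ → ℕ → Carrier
  cofactor₁ f zero    = 0#
  cofactor₁ f (suc n) = det (leading (minor₁ f) (suc n))

  -- The sign of column 1, which `_^_` unfolds to `- 1# * 1#`, cancels against the superdiagonal
  -- entry -1. This is why the expansions carry no signs.
  -1*1*-1≈1 : - 1# * 1# * - 1# ≈ 1#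
  -1*1*-1≈1 = begin
    - 1# * 1# * - 1#   ≈⟨ *-congʳ (*-identityʳ _) ⟩
    - 1# * - 1#        ≈⟨ -‿distribˡ-* 1# (- 1#) ⟨
    - (1# * - 1#)      ≈⟨ -‿cong (*-identityˡ _) ⟩
    - - 1#             ≈⟨ -‿involutive 1# ⟩
    1#                 ∎

  -- Row 0 vanishes from column 2 on, so only the minors of columns 0 and 1 survive.
  first-row-expansion : ∀ {f} → IsHessenberg f → ∀ n →
    det (leading f (suc n)) ≈ f 0 0 * det (leading (minor₀ f) n) + cofactor₁ f n
  -- In size 1 the rest of the row sum is empty, which matches the value `0#` of `cofactor₁ f 0`.
  first-row-expansion {f} H zero    = +-congʳ (*-congʳ (*-identityˡ (f 0 0)))
  first-row-expansion {f} H (suc n) = +-cong (*-congʳ (*-identityˡ (f 0 0))) (begin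
    - 1# * 1# * f 0 1 * det {suc n} (λ i k → f (suc (toℕ i)) (toℕ (punchIn (suc zero) k)))
      + sum {n} _
      ≈⟨ +-cong
           (*-cong (trans (*-congˡ (superdiagonal 0)) -1*1*-1≈1)
                   (det-cong {suc n} λ i k → reflexive (≡.cong (f (suc (toℕ i))) (toℕ-punchIn₁ k))))
           (trans
             (sum-cong-≋ {n} λ j → trans
               (*-congʳ (trans (*-congˡ (above 0 (suc (suc (toℕ j))) (s<s z<s))) (zeroʳ _)))
               (zeroˡ _))
             (sum-replicate-zero n)) ⟩
    1# * cofactor₁ f (suc n) + 0#
      ≈⟨ trans (+-identityʳ _) (*-identityˡ _) ⟩
    cofactor₁ f (suc n)
      ∎)
    where open IsHessenberg H

  -- Induction on the size, applied to both minors of the first row. An entry of the last row from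
  -- column 2 on occurs in both expansions, and its two factors recombine, by the first-row
  -- expansion read backwards, into the leading minor of `f` that goes with it.
  last-row-expansion : ∀ {f} → IsHessenberg f → ∀ n →
    det (leading f (suc n)) ≈ sum {suc n} λ j → f n (toℕ j) * det (leading f (toℕ j))
  -- In size 1 the first row is also the last.
  last-row-expansion {f} H zero    = first-row-expansion H 0
  last-row-expansion {f} H (suc n) = begin
    det (leading f (suc (suc n)))
      ≈⟨ first-row-expansion H (suc n) ⟩
    f 0 0 * det (leading (minor₀ f) (suc n)) + det (leading (minor₁ f) (suc n))
      ≈⟨ +-cong
           (trans (*-congˡ (last-row-expansion (minor₀-isHessenberg H) n))
                  (*-distribˡ-sum (f 0 0) s₀))
           (last-row-expansion (minor₁-isHessenberg H) n) ⟩
    -- The first term from `minor₁ f` is already the column 0 term of the goal, since the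
    -- determinant of size 0 is `1#`.
    sum (λ j → f 0 0 * s₀ j) + (f (suc n) 0 * 1# + sum {n} λ j → s₁ (suc j))
      ≈⟨ x+[y+z]≈y+[x+z] _ _ _ ⟩
    f (suc n) 0 * 1# + (sum (λ j → f 0 0 * s₀ j) + sum {n} λ j → s₁ (suc j))
      -- As `cofactor₁ f 0` is zero, so is `s₁ zero`; adding it lets both sums range over the same
      -- `j`.
      ≈⟨ +-congˡ (+-congˡ (trans (+-congʳ (zeroʳ _)) (+-identityˡ _))) ⟨
    f (suc n) 0 * 1# + (sum (λ j → f 0 0 * s₀ j) + sum s₁)
      ≈⟨ +-congˡ (∑-distrib-+ (λ j → f 0 0 * s₀ j) s₁) ⟨
    f (suc n) 0 * 1# + sum (λ j → f 0 0 * s₀ j + s₁ j)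
      ≈⟨ +-congˡ (sum-cong-≋ {suc n} λ j → begin
           f 0 0 * s₀ j + s₁ j
             ≈⟨ +-congʳ (x∙yz≈y∙xz _ _ _) ⟩
           a j * (f 0 0 * det (leading (minor₀ f) (toℕ j))) + a j * cofactor₁ f (toℕ j)
             ≈⟨ distribˡ (a j) _ _ ⟨
           a j * (f 0 0 * det (leading (minor₀ f) (toℕ j)) + cofactor₁ f (toℕ j))
             ≈⟨ *-congˡ (first-row-expansion H (toℕ j)) ⟨
           a j * det (leading f (suc (toℕ j)))
             ∎) ⟩
    f (suc n) 0 * 1# + sum {suc n} (λ j → a j * det (leading f (suc (toℕ j))))
      ∎
    where
    a s₀ s₁ : Vector Carrier (suc n)
    a  j = f (suc n) (suc (toℕ j))
    s₀ j = a j * det (leading (minor₀ f) (toℕ j))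
    s₁ j = a j * cofactor₁ f (toℕ j)

-- The matrix z H⁻¹ L - U and the recurrence of the polynomials.

open import Defs

open PolynomialRing ℝ-commutativeRing using (polynomialRing; const-cong; const-0; const-*)
open Hessenberg polynomialRing

module _ (h : (n : ℕ) .{{_ : NonZero n}} → ℝ)
         (h>0 : ∀ n .{{_ : NonZero n}} → 0ℝ < h n) where
  open D'Arcais h h>0
  private module ℝᴿ = CommutativeRing ℝ-commutativeRing
  open CommutativeRing polynomialRing using (setoid; refl; trans)
    renaming (+-cong to +ₚ-cong; +-congʳ to +ₚ-congʳ; +-identityˡ to +ₚ-identityˡ;
              +-identityʳ to +ₚ-identityʳ; -‿cong to -ₚ-cong; *-congˡ to *ₚ-congˡ;
              *-congʳ to *ₚ-congʳ; *-assoc to *ₚ-assoc; zeroʳ to *ₚ-zeroʳ;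
              reflexive to ≈ₚ-reflexive)
  open RingProperties (CommutativeRing.ring polynomialRing) using (-0#≈0#)
  open CommutativeMonoidSum (CommutativeRing.+-commutativeMonoid polynomialRing)
    using (sum-cong-≋; sum-permute)
  open SemiringSum (CommutativeRing.semiring polynomialRing) using (*-distribˡ-sum)
  open ≈-Reasoning setoid

  -- Indices start at 0: l i j and u i j are the entries (i + 1, j + 1) of L and U.
  l u : ℕ → ℕ → ℝ
  l i j = if does (j ℕ.≤? i) then fromℕ (σ (suc (i ∸ j))) else 0ℝ
  u i j = if does (j ℕ.≟ suc i) then 1ℝ else 0ℝ

  -- Since `H⁻¹` only scales rows, no entry depends on the size, and the matrices for all `n` are
  -- leading blocks of this one.
  zH⁻¹L-U : Matrix∞
  zH⁻¹L-U i j = X *ₚ const (h⁻¹ (suc i) * l i j) +ₚ -ₚ const (u i j)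

  l-below : ∀ {i j} → j ℕ.≤ i → l i j ≡ fromℕ (σ (suc (i ∸ j)))
  l-below {i} {j} j≤i rewrite dec-true (j ℕ.≤? i) j≤i = ≡.refl

  l-above : ∀ {i j} → i ℕ.< j → l i j ≡ 0ℝ
  l-above {i} {j} i<j rewrite dec-false (j ℕ.≤? i) (ℕ.<⇒≱ i<j) = ≡.refl

  u-superdiagonal : ∀ i → u i (suc i) ≡ 1ℝ
  u-superdiagonal i rewrite dec-true (suc i ℕ.≟ suc i) ≡.refl = ≡.refl

  u-off : ∀ {i j} → j ≡.≢ suc i → u i j ≡ 0ℝ
  u-off {i} {j} j≢1+i rewrite dec-false (j ℕ.≟ suc i) j≢1+i = ≡.refl

  -const0≈0 : -ₚ const 0ℝ ≈ₚ 0ₚ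
  -const0≈0 = trans (-ₚ-cong const-0) -0#≈0#

  -- `L` vanishes above the diagonal, so only -U is left: -1 next to the diagonal and 0 beyond.
  zH⁻¹L-U-above : ∀ {i j} → i ℕ.< j → zH⁻¹L-U i j ≈ₚ -ₚ const (u i j)
  zH⁻¹L-U-above {i} {j} i<j = trans
    (+ₚ-congʳ { -ₚ const (u i j)} (trans
      (*ₚ-congˡ {X} (trans
        (const-cong (ℝᴿ.trans (ℝᴿ.*-congˡ (ℝᴿ.reflexive (l-above i<j))) (ℝᴿ.zeroʳ (h⁻¹ (suc i)))))
        const-0))
      (*ₚ-zeroʳ X)))
    (+ₚ-identityˡ _)

  zH⁻¹L-U-isHessenberg : IsHessenberg zH⁻¹L-U
  zH⁻¹L-U-isHessenberg = record
    { superdiagonal = λ i → trans (zH⁻¹L-U-above ℕ.≤-refl)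
        (≈ₚ-reflexive (≡.cong (λ a → -ₚ const a) (u-superdiagonal i)))
    ; above = λ i j 1+i<j → trans (zH⁻¹L-U-above (ℕ.<-trans ℕ.≤-refl 1+i<j))
        (trans (≈ₚ-reflexive (≡.cong (λ a → -ₚ const a) (u-off (ℕ.>⇒≢ 1+i<j)))) -const0≈0) }

  -- `U` vanishes on and below the diagonal. The product is bracketed as in the recurrence defining
  -- `P`.
  zH⁻¹L-U-below : ∀ {i j} → j ℕ.≤ i →
    zH⁻¹L-U i j ≈ₚ X *ₚ const (h⁻¹ (suc i)) *ₚ const (fromℕ (σ (suc (i ∸ j))))
  zH⁻¹L-U-below {i} {j} j≤i = begin
    X *ₚ const (h⁻¹ (suc i) * l i j) +ₚ -ₚ const (u i j)
      ≡⟨ ≡.cong₂ (λ a b → X *ₚ const (h⁻¹ (suc i) * a) +ₚ -ₚ const b)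
           (l-below j≤i) (u-off (ℕ.<⇒≢ (ℕ.s≤s j≤i))) ⟩
    X *ₚ const (h⁻¹ (suc i) * s) +ₚ -ₚ const 0ℝ
      ≈⟨ +ₚ-cong (*ₚ-congˡ {X} (const-* (h⁻¹ (suc i)) s)) -const0≈0 ⟩
    X *ₚ (const (h⁻¹ (suc i)) *ₚ const s) +ₚ 0ₚ
      ≈⟨ +ₚ-identityʳ _ ⟩
    X *ₚ (const (h⁻¹ (suc i)) *ₚ const s)
      ≈⟨ *ₚ-assoc X (const (h⁻¹ (suc i))) (const s) ⟨
    X *ₚ const (h⁻¹ (suc i)) *ₚ const s
      ∎
    where s = fromℕ (σ (suc (i ∸ j)))

  -- Strong induction, because the recurrence reaches back to all earlier polynomials. Its sum over
  -- `i` is the last-row expansion over the columns `j = n ∸ i`.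
  P≈det-leading : ∀ n → P n ≈ₚ Matℝ[X].det (leading zH⁻¹L-U n)
  P≈det-leading = <-rec (λ n → P n ≈ₚ D n) step
    where
    D : ℕ → Poly
    D n = Matℝ[X].det (leading zH⁻¹L-U n)

    step : ∀ n → (∀ {m} → m ℕ.< n → P m ≈ₚ D m) → P n ≈ₚ D n
    step zero    IH = refl
    step (suc n) IH = begin
      P (suc n)
        ≈⟨ *ₚ-congˡ {z/h} (sum-cong-≋ {suc n} λ i → *ₚ-congˡ {σₚ (toℕ i)} (trans
             (≈ₚ-reflexive (lookup-history n i)) (IH (ℕ.s≤s (ℕ.m∸n≤m n (toℕ i)))))) ⟩
      z/h *ₚ Matℝ[X].sum {suc n} (λ i → σₚ (toℕ i) *ₚ D (n ∸ toℕ i))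
        ≈⟨ *-distribˡ-sum {suc n} z/h (λ i → σₚ (toℕ i) *ₚ D (n ∸ toℕ i)) ⟩
      Matℝ[X].sum {suc n} (λ i → z/h *ₚ (σₚ (toℕ i) *ₚ D (n ∸ toℕ i)))
        ≈⟨ sum-cong-≋ {suc n} (λ i → begin
             z/h *ₚ (σₚ (toℕ i) *ₚ D (n ∸ toℕ i))
               ≈⟨ *ₚ-assoc z/h (σₚ (toℕ i)) _ ⟨
             z/h *ₚ σₚ (toℕ i) *ₚ D (n ∸ toℕ i)
               -- The index of σ is rewritten through the column `n ∸ i`, so that the factor becomes
               -- an entry of row `n`.
               ≡⟨ ≡.cong (λ k → z/h *ₚ σₚ k *ₚ D (n ∸ toℕ i))
                    (ℕ.m∸[m∸n]≡n (Fin.toℕ≤pred[n] i)) ⟨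
             z/h *ₚ σₚ (n ∸ (n ∸ toℕ i)) *ₚ D (n ∸ toℕ i)
               ≈⟨ *ₚ-congʳ {D (n ∸ toℕ i)} (zH⁻¹L-U-below (ℕ.m∸n≤m n (toℕ i))) ⟨
             zH⁻¹L-U n (n ∸ toℕ i) *ₚ D (n ∸ toℕ i)
               ≡⟨ ≡.cong (λ k → zH⁻¹L-U n k *ₚ D k) (Fin.opposite-prop i) ⟨
             zH⁻¹L-U n (toℕ (opposite i)) *ₚ D (toℕ (opposite i))
               ∎) ⟩
      Matℝ[X].sum {suc n} (λ i → zH⁻¹L-U n (toℕ (opposite i)) *ₚ D (toℕ (opposite i)))
        -- The recurrence starts from `P n`, the expansion from the minor of size 0; reversing the
        -- order of summation matches them.
        ≈⟨ sum-permute {suc n} (λ j → zH⁻¹L-U n (toℕ j) *ₚ D (toℕ j)) reverse ⟨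
      Matℝ[X].sum {suc n} (λ j → zH⁻¹L-U n (toℕ j) *ₚ D (toℕ j))
        ≈⟨ last-row-expansion zH⁻¹L-U-isHessenberg n ⟨
      D (suc n)
        ∎
      where
      z/h : Poly
      z/h = X *ₚ const (h⁻¹ (suc n))
      σₚ : ℕ → Poly
      σₚ i = const (fromℕ (σ (suc i)))

  -- Only the entries of `H⁻¹ L` need an argument, by `diag-*ᴹ`; those of `U` agree by definition.
  leading≈ : ∀ n → leading zH⁻¹L-U n Matℝ[X].≈ᴹ
    (X Matℝ[X].·ᴹ constᴹ (H⁻¹ n Matℝ.*ᴹ L n) Matℝ[X].-ᴹ constᴹ (U n))
  leading≈ n i j = +ₚ-congʳ { -ₚ constᴹ (U n) i j} (*ₚ-congˡ {X} (const-cong (ℝᴿ.sym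
    (DiagonalProduct.diag-*ᴹ ℝ-commutativeRing (λ k → h⁻¹ (suc (toℕ k))) (L n) i j))))

proposition3p1 : (h : (n : ℕ) .{{_ : NonZero n}} → ℝ)
    (h>0 : ∀ n .{{_ : NonZero n}} → 0ℝ < h n) →
    h 1 ≈ 1ℝ →
    let open D'Arcais h h>0 in
    (n : ℕ) → .{{_ : NonZero n}} →
    P n ≈ₚ Matℝ[X].det (X Matℝ[X].·ᴹ constᴹ (H⁻¹ n Matℝ.*ᴹ L n) Matℝ[X].-ᴹ constᴹ (U n))
proposition3p1 h h>0 _ n =
  CommutativeRing.trans polynomialRing (P≈det-leading h h>0 n) (det-cong (leading≈ h h>0 n))
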